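{- Let $G$ be an unweighted graph (loops allowed). Let $F$ be a bipartite graph and let $\mathcal{H}$ be the class of all graphs that are cross-bipartite swapping in $G$. Then every $\mathcal{H}$-blow-up $H$ of $F$ is bipartite swapping in $G$, i.e. $\hom(H,G)^2\le\hom(H\times K_2,G)$.
   Context: $\hom(H,G)$ is the number of homomorphisms from $H$ to $G$. The tensor product $H\times K_2$ has vertex set $V(H)\times\{1,2\}$, with $(u,i)$ adjacent to $(v,j)$ iff $uv\in E(H)$ and $i\ne j$; its canonical bipartition is $(V(H)\times\{1\})\sqcup(V(H)\times\{2\})$. For $A,B\subseteq V(G)$, $\hom_{\mathrm b}(H\times K_2,G[A,B])$ is the number of homomorphisms $\phi:H\times K_2\to G$ with $\phi(V(H)\times\{1\})\subseteq A$ and $\phi(V(H)\times\{2\})\subseteq B$. A graph $H$ is cross-bipartite swapping in $G$ if for all $A,B\subseteq V(G)$, $\hom(H,G[A])\hom(H,G[B])\le\hom_{\mathrm b}(H\times K_2,G[A,B])$, where $G[A]$ is the induced subgraph. For a class $\mathcal{H}$ and a graph $F$ on vertices $v_1,\dots,v_k$, an $\mathcal{H}$-blow-up of $F$ is obtained by choosing $H_1,\dots,H_k\in\mathcal{H}$, taking their disjoint union, and adding all edges between $V(H_i)$ and $V(H_j)$ whenever $v_iv_j\in E(F)$. -}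

module Defs where

open import Level using (0ℓ)
open import Data.Bool using (Bool; true; false; T)
open import Data.Bool.Properties using (T?)
open import Data.Empty using (⊥-elim)
open import Data.Fin using (Fin; finToFun)
open import Data.Fin.Patterns using (0F; 1F)
import Data.Fin as Fin
open import Data.Fin.Properties using (all?; *↔×; +↔⊎; 0↔⊥; 1↔⊤; inj⇒≟)
open import Data.List using (length; filter; allFin)
open import Data.Nat using (ℕ; zero; suc; _+_; _*_; _^_; _≤_)
open import Data.Product using (Σ; ∃; _×_; _,_; proj₁; proj₂)
open import Data.Product.Algebra using (×-cong)
open import Data.Product.Function.Dependent.Propositional using (Σ-↔)
open import Data.Sum using (_⊎_; inj₁; inj₂)
open import Data.Sum.Function.Propositional using (_⊎-↔_)
open import Function using (_∘_; _↔_; mk↔ₛ′; Inverse)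
open import Function.Properties.Inverse using (↔-refl; ↔-sym; ↔-trans; ↔⇒↣)
open import Relation.Binary using (Rel; Decidable; DecidableEquality; Symmetric; Irreflexive)
open import Relation.Binary.PropositionalEquality using (_≡_; _≢_; refl; sym; subst)
open import Relation.Nullary using (¬_; Dec; yes; no)
open import Relation.Nullary.Decidable using (map′; ¬?; _×-dec_; _→-dec_)
open import Relation.Unary using (Pred)
import Relation.Unary as U
open import Axiom.UniquenessOfIdentityProofs using (module Decidable⇒UIP)

record Finite (A : Set) : Set where
  field
    size : ℕ
    enum : A ↔ Fin size

  open Inverse enum public using () renaming (to to index; from to element)

  _≟_ : DecidableEquality A
  _≟_ = inj⇒≟ (↔⇒↣ enum)

  decide-∀ : {P : Pred A 0ℓ} → U.Decidable P → Dec (∀ a → P a)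
  decide-∀ {P} P? = map′
    (λ h a → subst P (Inverse.strictlyInverseʳ enum a) (h (index a)))
    (λ h i → h (element i))
    (all? (λ i → P? (element i)))

×-finite : {A B : Set} → Finite A → Finite B → Finite (A × B)
×-finite a b = record
  { size = Finite.size a * Finite.size b
  ; enum = ↔-trans (×-cong (Finite.enum a) (Finite.enum b)) (↔-sym *↔×)
  }

Fin-finite : ∀ n → Finite (Fin n)
Fin-finite n = record { size = n ; enum = ↔-refl }

T-finite : ∀ b → Finite (T b)
T-finite true  = record { size = 1 ; enum = ↔-sym 1↔⊤ }
T-finite false = record { size = 0 ; enum = ↔-sym 0↔⊥ }

ΣFin-finite : ∀ n {B : Fin n → Set} → (∀ i → Finite (B i)) → Finite (Σ (Fin n) B)
ΣFin-finite zero    b = record { size = 0 ; enum = mk↔ₛ′ proj₁ (λ ()) (λ ()) (λ ()) }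
ΣFin-finite (suc n) {B} b = record
  { size = Finite.size (b Fin.zero) + Finite.size rest
  ; enum = ↔-trans split (↔-trans (Finite.enum (b Fin.zero) ⊎-↔ Finite.enum rest) (↔-sym +↔⊎))
  }
  where
  rest : Finite (Σ (Fin n) (B ∘ Fin.suc))
  rest = ΣFin-finite n (b ∘ Fin.suc)

  split : Σ (Fin (suc n)) B ↔ (B Fin.zero ⊎ Σ (Fin n) (B ∘ Fin.suc))
  split = mk↔ₛ′
    (λ { (Fin.zero , x) → inj₁ x ; (Fin.suc i , x) → inj₂ (i , x) })
    (λ { (inj₁ x) → Fin.zero , x ; (inj₂ (i , x)) → Fin.suc i , x })
    (λ { (inj₁ _) → refl ; (inj₂ _) → refl })
    (λ { (Fin.zero , _) → refl ; (Fin.suc _ , _) → refl })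

Σ-finite : {A : Set} {B : A → Set} → Finite A → (∀ a → Finite (B a)) → Finite (Σ A B)
Σ-finite {A} {B} a b = record
  { size = Finite.size total
  ; enum = ↔-trans (↔-sym (Σ-↔ (↔-sym (Finite.enum a)) ↔-refl)) (Finite.enum total)
  }
  where
  total : Finite (Σ (Fin (Finite.size a)) (B ∘ Finite.element a))
  total = ΣFin-finite (Finite.size a) (λ i → b (Finite.element a i))

-- The number of functions A → B satisfying P.  The codes Fin (∣B∣ ^ ∣A∣) are
-- in bijection, through finToFun and the enumerations of A and B, with the
-- functions A → B up to pointwise equality, so for a predicate P respecting
-- pointwise equality this does not depend on the enumerations.
countMaps : {A B : Set} → Finite A → Finite B →
            {P : Pred (A → B) 0ℓ} → U.Decidable P → ℕ
countMaps {A} {B} a b P? =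
  length (filter (λ c → P? (decode c)) (allFin (Finite.size b ^ Finite.size a)))
  where
  decode : Fin (Finite.size b ^ Finite.size a) → A → B
  decode c = Finite.element b ∘ finToFun c ∘ Finite.index a

-- Finite, undirected, unweighted graphs; loops are allowed.
record Graph : Set₁ where
  infix 4 _~_ _~?_
  field
    V      : Set
    finite : Finite V
    _~_    : Rel V 0ℓ
    _~?_   : Decidable _~_
    ~-sym  : Symmetric _~_

record SimpleGraph : Set₁ where
  field
    graph    : Graph
    loopless : Irreflexive _≡_ (Graph._~_ graph)

  open Graph graph public

open SimpleGraph using (graph)

IsHom : (H G : Graph) → Pred (Graph.V H → Graph.V G) 0ℓ
IsHom H G φ = ∀ u v → Graph._~_ H u v → Graph._~_ G (φ u) (φ v)

isHom? : (H G : Graph) → U.Decidable (IsHom H G)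
isHom? H G φ =
  H.decide-∀ λ u → H.decide-∀ λ v → (u H~? v) →-dec (φ u G~? φ v)
  where
  module H = Finite (Graph.finite H)
  open Graph H using () renaming (_~?_ to _H~?_)
  open Graph G using () renaming (_~?_ to _G~?_)

hom : SimpleGraph → Graph → ℕ
hom H G = countMaps (SimpleGraph.finite H) (Graph.finite G) (isHom? (graph H) G)

VertexSet : Graph → Set
VertexSet G = Graph.V G → Bool

infix 8 _[_] _×K₂

_[_] : (G : Graph) → VertexSet G → Graph
G [ A ] = record
  { V      = Σ V (λ v → T (A v))
  ; finite = Σ-finite finite (λ v → T-finite (A v))
  ; _~_    = λ x y → proj₁ x ~ proj₁ y
  ; _~?_   = λ x y → proj₁ x ~? proj₁ y
  ; ~-sym  = ~-sym
  }
  where open Graph G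

-- The two vertices 1, 2 of K₂ are represented by 0F, 1F : Fin 2.
_×K₂ : SimpleGraph → SimpleGraph
H ×K₂ = record
  { graph = record
    { V      = V × Fin 2
    ; finite = ×-finite finite (Fin-finite 2)
    ; _~_    = λ { (u , i) (v , j) → u ~ v × i ≢ j }
    ; _~?_   = λ { (u , i) (v , j) → (u ~? v) ×-dec ¬? (i Fin.≟ j) }
    ; ~-sym  = λ { (e , i≢j) → ~-sym e , i≢j ∘ sym }
    }
  ; loopless = λ { refl (_ , i≢i) → i≢i refl }
  }
  where open SimpleGraph H

MapsSidesInto : (H : SimpleGraph) (G : Graph) (A B : VertexSet G) →
                Pred (SimpleGraph.V (H ×K₂) → Graph.V G) 0ℓ
MapsSidesInto H G A B φ = (∀ u → T (A (φ (u , 0F)))) × (∀ u → T (B (φ (u , 1F))))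

mapsSidesInto? : ∀ H G A B → U.Decidable (MapsSidesInto H G A B)
mapsSidesInto? H G A B φ =
  H.decide-∀ (λ u → T? (A (φ (u , 0F)))) ×-dec H.decide-∀ (λ u → T? (B (φ (u , 1F))))
  where module H = Finite (SimpleGraph.finite H)

-- hom_b(H × K₂, G[A,B])
homᵇ : (H : SimpleGraph) (G : Graph) (A B : VertexSet G) → ℕ
homᵇ H G A B = countMaps (SimpleGraph.finite (H ×K₂)) (Graph.finite G)
  (λ φ → isHom? (graph (H ×K₂)) G φ ×-dec mapsSidesInto? H G A B φ)

CrossBipartiteSwapping : SimpleGraph → Graph → Set
CrossBipartiteSwapping H G =
  (A B : VertexSet G) → hom H (G [ A ]) * hom H (G [ B ]) ≤ homᵇ H G A B

BipartiteSwapping : SimpleGraph → Graph → Set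
BipartiteSwapping H G = hom H G ^ 2 ≤ hom (H ×K₂) G

Bipartite : SimpleGraph → Set
Bipartite F = ∃ λ (side : V → Fin 2) → ∀ u v → u ~ v → side u ≢ side v
  where open SimpleGraph F

module _ (F : SimpleGraph) (H : SimpleGraph.V F → SimpleGraph) where
  private
    module F = SimpleGraph F
    module H i = SimpleGraph (H i)

  data BlowUpAdj : Rel (Σ F.V H.V) 0ℓ where
    within : ∀ {i u v} → H._~_ i u v → BlowUpAdj (i , u) (i , v)
    across : ∀ {i j u v} → i F.~ j → BlowUpAdj (i , u) (j , v)

  private
    open Finite F.finite using (_≟_)
    open Decidable⇒UIP _≟_ using (≡-irrelevant)

    within⁻¹ : ∀ {i j u v} (p : i ≡ j) → BlowUpAdj (i , u) (j , v) → ¬ (i F.~ j) →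
               H._~_ j (subst H.V p u) v
    within⁻¹ p (within e) _ with refl ← ≡-irrelevant p refl = e
    within⁻¹ p (across a) n = ⊥-elim (n a)

    adj? : Decidable BlowUpAdj
    adj? (i , u) (j , v) with F._~?_ i j
    ... | yes a = yes (across a)
    ... | no ¬a with i ≟ j
    ...   | no i≢j = no λ { (within _) → i≢j refl ; (across a) → ¬a a }
    ...   | yes refl = map′ within (λ e → within⁻¹ refl e ¬a) (H._~?_ i u v)

    adj-sym : Symmetric BlowUpAdj
    adj-sym (within {i} e) = within (H.~-sym i e)
    adj-sym (across a)     = across (F.~-sym a)

    adj-loopless : ∀ {x y} → x ≡ y → ¬ BlowUpAdj x y
    adj-loopless {i , u} refl e = H.loopless i refl (within⁻¹ refl e (F.loopless refl))

  blowUp : SimpleGraph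
  blowUp = record
    { graph = record
      { V      = Σ F.V H.V
      ; finite = Σ-finite F.finite (λ i → H.finite i)
      ; _~_    = BlowUpAdj
      ; _~?_   = adj?
      ; ~-sym  = adj-sym
      }
    ; loopless = adj-loopless
    }

data IsBlowUp (𝓗 : Pred SimpleGraph 0ℓ) (F : SimpleGraph) : SimpleGraph → Set₁ where
  blow-up : (H : SimpleGraph.V F → SimpleGraph) → (∀ i → 𝓗 (H i)) →
            IsBlowUp 𝓗 F (blowUp F H)

-- A pair of homomorphisms H → G is a map from two layers of H to G.  Call a
-- block V(H_i) straight if its edges are respected within each layer, crossed
-- if they are respected between the layers; edges between blocks are always
-- respected within each layer.  Pairs of homomorphisms have all blocks
-- straight.  If all blocks are crossed, exchanging the two layers over one side
-- of F gives a homomorphism H × K₂ → G.  Given the rest of the map, the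
-- conditions on block i are that it is straight (or crossed) and that layer b
-- maps into A_b, the common neighbourhood of the image under layer b of the
-- adjacent blocks; so cross-bipartite swapping with A = A_0, B = A_1 yields an
-- injection from straight to crossed blocks.  Blocks on one side of F are not
-- adjacent and can be replaced simultaneously: first side 0, then side 1.

module Submission where

open import Defs

open import Level using (0ℓ)
open import Data.Bool using (Bool; T)
open import Data.Empty using (⊥-elim)
open import Data.Fin using (Fin; finToFun; funToFin; combine; inject≤; _≟_)
open import Data.Fin.Patterns using (0F; 1F)
open import Data.Fin.Properties
  using (funToFin-finToFin; finToFun-funToFin; combine-injective; inject≤-injective; injective⇒≤)
open import Data.List using (List; filter; allFin)
import Data.List as List
open import Data.List.Membership.Propositional using (_∈_)
open import Data.List.Membership.Propositional.Properties
  using (∈-filter⁺; ∈-filter⁻; ∈-allFin; ∈-lookup)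
import Data.List.Relation.Unary.Any as Any
open import Data.List.Relation.Unary.Any.Properties using (lookup-index)
import Data.List.Relation.Unary.AllPairs as AllPairs
import Data.List.Relation.Unary.All as All
open import Data.List.Relation.Unary.Unique.Propositional using (Unique)
open import Data.List.Relation.Unary.Unique.Propositional.Properties using (filter⁺; allFin⁺)
open import Data.Nat using (ℕ; zero; suc; _^_)
open import Data.Product using (∃; _×_; _,_; proj₁; proj₂)
open import Data.Vec using (Vec; tabulate; lookup)
open import Data.Vec.Properties using (lookup∘tabulate; tabulate-cong)
open import Function using (_∘_; Inverse; _⇔_; mk⇔)
open import Relation.Binary using (Rel; _⇒_)
open import Relation.Binary.PropositionalEquality
  using (_≡_; _≢_; _≗_; refl; sym; trans; cong; cong₂; subst; subst₂)
open import Relation.Nullary using (Dec; yes; no)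
open import Relation.Nullary.Decidable
  using (isYes; toWitness; fromWitness; isYes≗does; does-⇔; _×-dec_; _→-dec_)
open import Relation.Unary using (Pred)
import Relation.Unary as U

-- Injective enumeration of the maps counted by `countMaps`.

lookup-injective : ∀ {A : Set} {xs : List A} → Unique xs → ∀ {i j} →
                   List.lookup xs i ≡ List.lookup xs j → i ≡ j
lookup-injective (x∉xs AllPairs.∷ xs!) {0F} {0F} eq = refl
lookup-injective {xs = _ List.∷ xs} (x∉xs AllPairs.∷ xs!) {0F} {Fin.suc j} eq =
  ⊥-elim (All.lookup x∉xs (∈-lookup {xs = xs} j) eq)
lookup-injective {xs = _ List.∷ xs} (x∉xs AllPairs.∷ xs!) {Fin.suc i} {0F} eq =
  ⊥-elim (All.lookup x∉xs (∈-lookup {xs = xs} i) (sym eq))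
lookup-injective (x∉xs AllPairs.∷ xs!) {Fin.suc i} {Fin.suc j} eq =
  cong Fin.suc (lookup-injective xs! eq)

funToFin-cong : ∀ {m n} {f g : Fin m → Fin n} → f ≗ g → funToFin f ≡ funToFin g
funToFin-cong {zero}  f≗g = refl
funToFin-cong {suc m} f≗g = cong₂ combine (f≗g 0F) (funToFin-cong (f≗g ∘ Fin.suc))

finToFun-injective : ∀ {m n} {c d : Fin (n ^ m)} → finToFun {n} {m} c ≗ finToFun d → c ≡ d
finToFun-injective {m} {n} {c} {d} eq = trans (sym (funToFin-finToFin {m} {n} c))
  (trans (funToFin-cong eq) (funToFin-finToFin {m} {n} d))

module CountMaps {A B : Set} (a : Finite A) (b : Finite B)
                 {P : Pred (A → B) 0ℓ} (P? : U.Decidable P) where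
  private
    module A = Finite a
    module B = Finite b

    Code = Fin (B.size ^ A.size)

    decode : Code → A → B
    decode c = B.element ∘ finToFun c ∘ A.index

    decode-injective : ∀ {c d} → decode c ≗ decode d → c ≡ d
    decode-injective {c} {d} eq = finToFun-injective λ i →
      subst (λ j → finToFun c j ≡ finToFun d j) (Inverse.strictlyInverseˡ A.enum i)
        (trans (sym (Inverse.strictlyInverseˡ B.enum _))
          (trans (cong B.index (eq (A.element i))) (Inverse.strictlyInverseˡ B.enum _)))

    encode : (A → B) → Code
    encode f = funToFin (B.index ∘ f ∘ A.element)

    decode∘encode : ∀ f → decode (encode f) ≗ f
    decode∘encode f x = trans (cong B.element (finToFun-funToFin _ (A.index x)))
      (trans (Inverse.strictlyInverseʳ B.enum _)
        (cong f (Inverse.strictlyInverseʳ A.enum x)))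

    Q? : U.Decidable (P ∘ decode)
    Q? c = P? (decode c)

    codes : List Code
    codes = filter Q? (allFin (B.size ^ A.size))

  count : ℕ
  count = countMaps a b P?

  map-at : Fin count → ∃ P
  map-at k = decode (List.lookup codes k) ,
             proj₂ (∈-filter⁻ Q? {xs = allFin _} (∈-lookup {xs = codes} k))

  -- The filtered list of codes has no repetitions, and pointwise equal decoded maps have equal
  -- codes.
  map-at-injective : ∀ {k l} → proj₁ (map-at k) ≗ proj₁ (map-at l) → k ≡ l
  map-at-injective eq = lookup-injective (filter⁺ Q? (allFin⁺ _)) (decode-injective eq)

  module _ (resp : ∀ {f g} → f ≗ g → P f → P g) where
    private
      -- `decode (encode f)` agrees with `f` only pointwise, hence the hypothesis `resp`.
      code∈ : ((f , _) : ∃ P) → encode f ∈ codes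
      code∈ (f , p) = ∈-filter⁺ Q? (∈-allFin _) (resp (sym ∘ decode∘encode f) p)

    position : ∃ P → Fin count
    position f = Any.index (code∈ f)

    position-injective : ∀ f g → position f ≡ position g → proj₁ f ≗ proj₁ g
    position-injective f g eq x =
      trans (sym (decode∘encode (proj₁ f) x))
        (trans (cong (λ c → decode c x) code≡) (decode∘encode (proj₁ g) x))
      where
      code≡ : encode (proj₁ f) ≡ encode (proj₁ g)
      code≡ = trans (lookup-index (code∈ f))
        (trans (cong (List.lookup codes) eq) (sym (lookup-index (code∈ g))))

IsHom-resp-≗ : ∀ H G {φ ψ} → φ ≗ ψ → IsHom H G φ → IsHom H G ψ
IsHom-resp-≗ H G eq h u v e = subst₂ (Graph._~_ G) (eq u) (eq v) (h u v e)

-- Vertex sets as Boolean vectors.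

-- Without function extensionality, vertex sets with the same elements need not
-- be equal; their characteristic vectors are.
module CharacteristicVector {A : Set} (a : Finite A) where
  open Finite a

  members : Vec Bool size → A → Bool
  members c x = lookup c (index x)

  characteristic : {P : Pred A 0ℓ} → U.Decidable P → Vec Bool size
  characteristic P? = tabulate (λ k → isYes (P? (element k)))

  members-characteristic : {P : Pred A 0ℓ} (P? : U.Decidable P) →
                           members (characteristic P?) ≗ isYes ∘ P?
  members-characteristic P? x = trans (lookup∘tabulate _ (index x))
    (cong (isYes ∘ P?) (Inverse.strictlyInverseʳ enum x))

  ∈-characteristic⁺ : {P : Pred A 0ℓ} (P? : U.Decidable P) →
                      ∀ {x} → P x → T (members (characteristic P?) x)
  ∈-characteristic⁺ P? {x} p = subst T (sym (members-characteristic P? x)) (fromWitness p)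

  ∈-characteristic⁻ : {P : Pred A 0ℓ} (P? : U.Decidable P) →
                      ∀ {x} → T (members (characteristic P?) x) → P x
  ∈-characteristic⁻ P? {x} t = toWitness (subst T (members-characteristic P? x) t)

  characteristic-cong : {P Q : Pred A 0ℓ} (P? : U.Decidable P) (Q? : U.Decidable Q) →
                        (∀ x → P x ⇔ Q x) → characteristic P? ≡ characteristic Q?
  characteristic-cong P? Q? P⇔Q = tabulate-cong λ k →
    let x = element k in
    trans (isYes≗does (P? x)) (trans (does-⇔ (P⇔Q x) (P? x) (Q? x)) (sym (isYes≗does (Q? x))))

-- Exchange within a single block.

module _ (K : SimpleGraph) (G : Graph) where
  private
    module K = SimpleGraph K
    module G = Graph G

  -- With link `_≡_` this is a pair of homomorphisms, from K to G[A 0F] and to G[A 1F]; with `_≢_`,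
  -- a homomorphism counted by `homᵇ`.
  record Block (link : Rel (Fin 2) 0ℓ) (A : Fin 2 → VertexSet G) : Set where
    field
      layer  : Fin 2 → K.V → G.V
      into   : ∀ b u → T (A b (layer b u))
      inside : ∀ {b b′ u v} → link b b′ → u K.~ v → layer b u G.~ layer b′ v

  open Block

  module Exchange (cbs : CrossBipartiteSwapping K G) (A : Fin 2 → VertexSet G) where
    private
      module Hom b = CountMaps K.finite (Graph.finite (G [ A b ]))
                               (isHom? (SimpleGraph.graph K) (G [ A b ]))
      module Homᵇ = CountMaps (SimpleGraph.finite (K ×K₂)) G.finite
        (λ φ → isHom? (SimpleGraph.graph (K ×K₂)) G φ ×-dec mapsSidesInto? K G (A 0F) (A 1F) φ)

      homOf : Block _≡_ A → ∀ b → ∃ (IsHom (SimpleGraph.graph K) (G [ A b ]))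
      homOf X b = (λ u → layer X b u , into X b u) , λ _ _ → inside X refl

      resp : ∀ b {φ ψ} → φ ≗ ψ → IsHom (SimpleGraph.graph K) (G [ A b ]) φ →
             IsHom (SimpleGraph.graph K) (G [ A b ]) ψ
      resp b = IsHom-resp-≗ (SimpleGraph.graph K) (G [ A b ])

      homPosition : Block _≡_ A → ∀ b → Fin (Hom.count b)
      homPosition X b = Hom.position b (resp b) (homOf X b)

      -- Cross-bipartite swapping enters here: `combine` codes the two positions below the product
      -- of the counts, and `cbs` enlarges the bound.
      number : Block _≡_ A → Fin (homᵇ K G (A 0F) (A 1F))
      number X = inject≤ (combine (homPosition X 0F) (homPosition X 1F)) (cbs (A 0F) (A 1F))

      homPosition-injective : ∀ X Y b → homPosition X b ≡ homPosition Y b → layer X b ≗ layer Y b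
      homPosition-injective X Y b eq u =
        cong proj₁ (Hom.position-injective b (resp b) (homOf X b) (homOf Y b) eq u)

      number-injective : ∀ X Y → number X ≡ number Y → ∀ b → layer X b ≗ layer Y b
      number-injective X Y eq b = homPosition-injective X Y b (at b)
        where
        both = combine-injective (homPosition X 0F) (homPosition X 1F) _ _
                 (inject≤-injective _ _ _ _ eq)

        at : ∀ b → homPosition X b ≡ homPosition Y b
        at 0F = proj₁ both
        at 1F = proj₂ both

    -- Any injection into the maps counted by `homᵇ` will do, so the number of the pair is read as
    -- an index into their list.
    exchange : Block _≡_ A → Block _≢_ A
    exchange X with φ , hom , into₀ , into₁ ← Homᵇ.map-at (number X) = record
      { layer  = λ b u → φ (u , b)
      ; into   = λ { 0F → into₀ ; 1F → into₁ }
      ; inside = λ b≢b′ e → hom _ _ (e , b≢b′)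
      }

    exchange-injective : ∀ X Y → (∀ b → layer (exchange X) b ≗ layer (exchange Y) b) →
                         ∀ b → layer X b ≗ layer Y b
    exchange-injective X Y eq =
      number-injective X Y (Homᵇ.map-at-injective λ { (u , b) → eq b u })

-- Replacing all blocks on one side of F.

module _ (G : Graph) (F : SimpleGraph) (H : SimpleGraph.V F → SimpleGraph)
         (cbs : ∀ i → CrossBipartiteSwapping (H i) G)
         (side : SimpleGraph.V F → Fin 2)
         (proper : ∀ i j → SimpleGraph._~_ F i j → side i ≢ side j) where
  private
    module G = Graph G
    module F = SimpleGraph F
    module H i = SimpleGraph (H i)
    BH = blowUp F H
    module BH = SimpleGraph BH

  open CharacteristicVector G.finite

  -- link s relates the layers between which the edges of the blocks on side s
  -- of F are respected: _≡_ for straight blocks, _≢_ for crossed ones.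
  record Hybrid (link : Fin 2 → Rel (Fin 2) 0ℓ) : Set where
    field
      layer  : Fin 2 → BH.V → G.V
      inside : ∀ {i b b′ u v} → link (side i) b b′ → H._~_ i u v →
               layer b (i , u) G.~ layer b′ (i , v)
      between : ∀ {i j b u v} → i F.~ j → layer b (i , u) G.~ layer b (j , v)

  open Hybrid

  infix 4 _≋_
  _≋_ : ∀ {link link′} → Hybrid link → Hybrid link′ → Set
  x ≋ y = ∀ b → layer x b ≗ layer y b

  -- Only inclusions between links are assumed, so one argument serves both sides: blocks on side
  -- `s` turn from straight to crossed, the others inherit their condition.
  module Step (s : Fin 2) {link link′ : Fin 2 → Rel (Fin 2) 0ℓ}
              (straight : _≡_ ⇒ link s) (crossed : link′ s ⇒ _≢_)
              (unchanged : ∀ {t} → t ≢ s → link′ t ⇒ link t) where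
    private
      CommonNeighbour : (Fin 2 → BH.V → G.V) → F.V → Fin 2 → Pred G.V 0ℓ
      CommonNeighbour f i b x = ∀ j → i F.~ j → ∀ v → x G.~ f b (j , v)

      commonNeighbour? : ∀ f i b → U.Decidable (CommonNeighbour f i b)
      commonNeighbour? f i b x =
        Finite.decide-∀ F.finite λ j → (i F.~? j) →-dec
          Finite.decide-∀ (H.finite j) λ v → x G.~? f b (j , v)

      -- The pair A_0, A_1 is a vector too, so that equal neighbourhoods have propositionally equal
      -- codes.
      Codes = Vec (Vec Bool (Finite.size G.finite)) 2

      sets : Codes → Fin 2 → VertexSet G
      sets c b = members (lookup c b)

      nbhd : (Fin 2 → BH.V → G.V) → F.V → Codes
      nbhd f i = tabulate (λ b → characteristic (commonNeighbour? f i b))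

      lookup-nbhd : ∀ f i b → lookup (nbhd f i) b ≡ characteristic (commonNeighbour? f i b)
      lookup-nbhd f i = lookup∘tabulate (λ b → characteristic (commonNeighbour? f i b))

      ∈-nbhd⁺ : ∀ f i b {x} → CommonNeighbour f i b x → T (sets (nbhd f i) b x)
      ∈-nbhd⁺ f i b {x} n = subst (λ c → T (members c x)) (sym (lookup-nbhd f i b))
        (∈-characteristic⁺ (commonNeighbour? f i b) n)

      ∈-nbhd⁻ : ∀ f i b {x} → T (sets (nbhd f i) b x) → CommonNeighbour f i b x
      ∈-nbhd⁻ f i b {x} t = ∈-characteristic⁻ (commonNeighbour? f i b)
        (subst (λ c → T (members c x)) (lookup-nbhd f i b) t)

      nbhd-cong : ∀ {f g} i → (∀ b j → i F.~ j → ∀ v → f b (j , v) ≡ g b (j , v)) →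
                  nbhd f i ≡ nbhd g i
      nbhd-cong {f} {g} i eq = tabulate-cong λ b →
        characteristic-cong (commonNeighbour? f i b) (commonNeighbour? g i b) λ x → mk⇔
          (λ n j e v → subst (x G.~_) (eq b j e v) (n j e v))
          (λ n j e v → subst (x G.~_) (sym (eq b j e v)) (n j e v))

      module E i c = Exchange (H i) G (cbs i) (sets c)

      block : (x : Hybrid link) (i : F.V) → side i ≡ s →
              Block (H i) G _≡_ (sets (nbhd (layer x) i))
      block x i i∈s = record
        { layer  = λ b u → layer x b (i , u)
        ; into   = λ b u → ∈-nbhd⁺ (layer x) i b (λ _ e _ → between x e)
        ; inside = λ { refl → inside x (subst (λ t → link t _ _) (sym i∈s) (straight refl)) }
        }

      newBlock : (x : Hybrid link) (i : F.V) → side i ≡ s →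
                 Block (H i) G _≢_ (sets (nbhd (layer x) i))
      newBlock x i i∈s = E.exchange i (nbhd (layer x) i) (block x i i∈s)

      newLayerAt : Hybrid link → ∀ i → Dec (side i ≡ s) → Fin 2 → H.V i → G.V
      newLayerAt x i (yes i∈s) = Block.layer (newBlock x i i∈s)
      newLayerAt x i (no _)    = λ b u → layer x b (i , u)

      newLayer : Hybrid link → Fin 2 → BH.V → G.V
      newLayer x b (i , u) = newLayerAt x i (side i ≟ s) b u

      newLayer-unchanged : ∀ x {i} → side i ≢ s → ∀ b u → newLayer x b (i , u) ≡ layer x b (i , u)
      newLayer-unchanged x {i} i∉s b u with side i ≟ s
      ... | yes i∈s = ⊥-elim (i∉s i∈s)
      ... | no _    = refl

      neighbour∉ : ∀ {i j} → side i ≡ s → i F.~ j → side j ≢ s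
      neighbour∉ i∈s e j∈s = proper _ _ e (trans i∈s (sym j∈s))

      -- The new block still maps into the common neighbourhoods formed from `layer x`; blocks
      -- adjacent to `i` lie on the other side and keep these layers.
      newBlock-between : ∀ x {i j} (i∈s : side i ≡ s) → i F.~ j → ∀ b u v →
                        Block.layer (newBlock x i i∈s) b u G.~ layer x b (j , v)
      newBlock-between x {i} i∈s e b u v =
        ∈-nbhd⁻ (layer x) i b (Block.into (newBlock x i i∈s) b u) _ e v

    step : Hybrid link → Hybrid link′
    step x = record { layer = newLayer x ; inside = inside′ ; between = between′ }
      where
      inside′ : ∀ {i b b′ u v} → link′ (side i) b b′ → H._~_ i u v →
                newLayer x b (i , u) G.~ newLayer x b′ (i , v)
      inside′ {i} l e with side i ≟ s
      ... | yes i∈s = Block.inside (newBlock x i i∈s)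
                        (crossed (subst (λ t → link′ t _ _) i∈s l)) e
      ... | no i∉s  = inside x (unchanged i∉s l) e

      between′ : ∀ {i j b u v} → i F.~ j → newLayer x b (i , u) G.~ newLayer x b (j , v)
      between′ {i} {j} {b} {u} {v} e with side i ≟ s | side j ≟ s
      ... | yes i∈s | yes j∈s = ⊥-elim (neighbour∉ i∈s e j∈s)
      ... | yes i∈s | no _    = newBlock-between x i∈s e b u v
      ... | no _    | yes j∈s = G.~-sym (newBlock-between x j∈s (F.~-sym e) b v u)
      ... | no _    | no _    = between x e

    private
      -- `exchange` depends on the code of the two sets, so its results can be compared only once
      -- the codes are identified.
      exchange-injective′ : ∀ i {c d} → c ≡ d →
        (X : Block (H i) G _≡_ (sets c)) (Y : Block (H i) G _≡_ (sets d)) →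
        (∀ b → Block.layer (E.exchange i c X) b ≗ Block.layer (E.exchange i d Y) b) →
        ∀ b → Block.layer X b ≗ Block.layer Y b
      exchange-injective′ i {c} refl = E.exchange-injective i c

    -- Blocks off side `s` are read off directly. They determine the neighbourhood codes of the
    -- blocks on side `s`, so both hybrids undergo the same injective exchange there.
    step-injective : ∀ x y → step x ≋ step y → x ≋ y
    -- The equation on block `i` is abstracted together with the decision, so that each branch sees
    -- it reduced; `eq` itself remains for the neighbours.
    step-injective x y eq b (i , u) with side i ≟ s | (λ b u → eq b (i , u))
    ... | no _    | eqᵢ = eqᵢ b u
    ... | yes i∈s | eqᵢ = exchange-injective′ i same-nbhd (block x i i∈s) (block y i i∈s) eqᵢ b u
      where
      same-nbhd : nbhd (layer x) i ≡ nbhd (layer y) i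
      same-nbhd = nbhd-cong i λ b j e v →
        trans (sym (newLayer-unchanged x (neighbour∉ i∈s e) b v))
          (trans (eq b (j , v)) (newLayer-unchanged y (neighbour∉ i∈s e) b v))

  -- From pairs of homomorphisms to homomorphisms on H × K₂.

  private
    module Hom  = CountMaps BH.finite G.finite (isHom? (SimpleGraph.graph BH) G)
    module Hom₂ = CountMaps (SimpleGraph.finite (BH ×K₂)) G.finite
                            (isHom? (SimpleGraph.graph (BH ×K₂)) G)

    -- Links between the two steps: side 0 already crossed, side 1 still straight.
    half : Fin 2 → Rel (Fin 2) 0ℓ
    half 0F = _≢_
    half 1F = _≡_

    unchanged₀ : ∀ {t} → t ≢ 0F → half t ⇒ _≡_
    unchanged₀ {0F} t≢0 = ⊥-elim (t≢0 refl)
    unchanged₀ {1F} _   = λ eq → eq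

    unchanged₁ : ∀ {t} → t ≢ 1F → _≢_ ⇒ half t
    unchanged₁ {0F} _   = λ neq → neq
    unchanged₁ {1F} t≢1 = ⊥-elim (t≢1 refl)

    module Step₀ = Step 0F {λ _ → _≡_} {half} (λ eq → eq) (λ neq → neq) unchanged₀
    module Step₁ = Step 1F {half} {λ _ → _≢_} (λ eq → eq) (λ neq → neq) unchanged₁

    fromPair : Fin (hom BH G ^ 2) → Hybrid (λ _ → _≡_)
    fromPair c = record
      { layer  = λ b → proj₁ (φ b)
      ; inside = λ { {b = b} refl e → proj₂ (φ b) _ _ (within e) }
      ; between = λ {_} {_} {b} e → proj₂ (φ b) _ _ (across e)
      }
      where
      φ : Fin 2 → ∃ (IsHom (SimpleGraph.graph BH) G)
      -- An element of `Fin (n ^ 2)` codes a function on `Fin 2`: one homomorphism index per layer.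
      φ b = Hom.map-at (finToFun {hom BH G} {2} c b)

    fromPair-injective : ∀ c d → fromPair c ≋ fromPair d → c ≡ d
    fromPair-injective c d eq = finToFun-injective {2} {hom BH G} λ b → Hom.map-at-injective (eq b)

    -- The first argument is the side of a block: layers are exchanged over side 1 only.
    flip : Fin 2 → Fin 2 → Fin 2
    flip 0F b  = b
    flip 1F 0F = 1F
    flip 1F 1F = 0F

    flip-involutive : ∀ s b → flip s (flip s b) ≡ b
    flip-involutive 0F b  = refl
    flip-involutive 1F 0F = refl
    flip-involutive 1F 1F = refl

    flip-injective : ∀ s {b b′} → flip s b ≡ flip s b′ → b ≡ b′
    flip-injective s eq =
      trans (sym (flip-involutive s _)) (trans (cong (flip s) eq) (flip-involutive s _))

    -- Adjacent blocks lie on different sides, so exactly one end is flipped: edges of H × K₂ across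
    -- blocks come to lie within one layer, where `between` applies.
    flip-≢ : ∀ {s t b b′} → s ≢ t → b ≢ b′ → flip s b ≡ flip t b′
    flip-≢ {0F} {0F} s≢t _ = ⊥-elim (s≢t refl)
    flip-≢ {1F} {1F} s≢t _ = ⊥-elim (s≢t refl)
    flip-≢ {0F} {1F} {0F} {0F} _ b≢b′ = ⊥-elim (b≢b′ refl)
    flip-≢ {0F} {1F} {0F} {1F} _ _    = refl
    flip-≢ {0F} {1F} {1F} {0F} _ _    = refl
    flip-≢ {0F} {1F} {1F} {1F} _ b≢b′ = ⊥-elim (b≢b′ refl)
    flip-≢ {1F} {0F} {0F} {0F} _ b≢b′ = ⊥-elim (b≢b′ refl)
    flip-≢ {1F} {0F} {0F} {1F} _ _    = refl
    flip-≢ {1F} {0F} {1F} {0F} _ _    = refl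
    flip-≢ {1F} {0F} {1F} {1F} _ b≢b′ = ⊥-elim (b≢b′ refl)

    toHom : Hybrid (λ _ → _≢_) → ∃ (IsHom (SimpleGraph.graph (BH ×K₂)) G)
    toHom x = φ , isHom
      where
      φ : BH.V × Fin 2 → G.V
      φ ((i , u) , b) = layer x (flip (side i) b) (i , u)

      isHom : IsHom (SimpleGraph.graph (BH ×K₂)) G φ
      -- Both ends have the same side, so flipping keeps their layers distinct, as a crossed block
      -- requires.
      isHom ((i , _) , b) (_ , b′) (within e , b≢b′) =
        inside x (b≢b′ ∘ flip-injective (side i)) e
      isHom ((i , u) , b) ((j , v) , b′) (across e , b≢b′) =
        subst (λ c → layer x (flip (side i) b) (i , u) G.~ layer x c (j , v))
          (flip-≢ (proper i j e) b≢b′) (between x e)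

    toHom-injective : ∀ x y → proj₁ (toHom x) ≗ proj₁ (toHom y) → x ≋ y
    toHom-injective x y eq b (i , u) =
      subst (λ c → layer x c (i , u) ≡ layer y c (i , u)) (flip-involutive (side i) b)
        (eq ((i , u) , flip (side i) b))

    resp : ∀ {φ ψ} → φ ≗ ψ → IsHom (SimpleGraph.graph (BH ×K₂)) G φ →
           IsHom (SimpleGraph.graph (BH ×K₂)) G ψ
    resp = IsHom-resp-≗ (SimpleGraph.graph (BH ×K₂)) G

  -- Each stage is injective up to pointwise equality, so the composite is an injection between
  -- `Fin` types and compares their sizes.
  blowUp-bipartiteSwapping : BipartiteSwapping BH G
  blowUp-bipartiteSwapping = injective⇒≤ {f = Hom₂.position resp ∘ toHom ∘ cross} λ {c} {d} eq →
    fromPair-injective c d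
      (Step₀.step-injective _ _ (Step₁.step-injective _ _
        (toHom-injective (cross c) (cross d)
          (Hom₂.position-injective resp (toHom (cross c)) (toHom (cross d)) eq))))
    where
    cross : Fin (hom BH G ^ 2) → Hybrid (λ _ → _≢_)
    cross = Step₁.step ∘ Step₀.step ∘ fromPair

theorem5p1 : (G : Graph) (F : SimpleGraph) → Bipartite F →
    (H : SimpleGraph) → IsBlowUp (λ K → CrossBipartiteSwapping K G) F H →
    BipartiteSwapping H G
theorem5p1 G F (side , proper) _ (blow-up H cbs) =
  blowUp-bipartiteSwapping G F H cbs side proper
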